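{- For any $\mathcal{ELCD}$-formula $\varphi$, any model $M$ and any state $s$ of $M$: $M,s\models\varphi$ if and only if $M^\sigma,s\Vdash\varphi$, where $M^\sigma$ is the standard translation of $M$.
   Context: Fix a countably infinite set $\mathsf{Prop}$ and a finite nonempty set $\mathsf{Ag}$ of agents; groups are nonempty subsets of $\mathsf{Ag}$. $\mathcal{ELCD}$-formulas: $\varphi::=p\mid\neg\varphi\mid(\varphi\to\varphi)\mid K_a\varphi\mid C_G\varphi\mid D_G\varphi$ ($p\in\mathsf{Prop}$, $a\in\mathsf{Ag}$, $G$ a group). $E_G\varphi:=\bigwedge_{a\in G}K_a\varphi$, $E_G^1\varphi:=E_G\varphi$, $E_G^{n}\varphi:=E_GE_G^{n-1}\varphi$. A model is a tuple $M=(W,A,E,C,\nu)$ with $W$ a nonempty set, $A$ an arbitrary set, $E:W\times W\to\wp(A)$, $C:\mathsf{Ag}\to\wp(A)$, $\nu:W\to\wp(\mathsf{Prop})$. Satisfaction: $M,s\models p$ iff $p\in\nu(s)$; Booleans as usual; $M,s\models K_a\psi$ iff for all $t\in W$, $C(a)\subseteq E(s,t)$ implies $M,t\models\psi$; $M,s\models C_G\psi$ iff $M,s\models E_G^n\psi$ for all $n\ge1$; $M,s\models D_G\psi$ iff for all $t\in W$, $\bigcup_{a\in G}C(a)\subseteq E(s,t)$ implies $M,t\models\psi$. A relational model is $N=(W,R,V)$ with $W$ nonempty, $R:\mathsf{Ag}\to\wp(W\times W)$ (arbitrary binary relations), $V:\mathsf{Prop}\to\wp(W)$. Satisfaction $\Vdash$: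 $N,s\Vdash p$ iff $s\in V(p)$; Booleans as usual; $N,s\Vdash K_a\psi$ iff for all $t$ with $(s,t)\in R(a)$, $N,t\Vdash\psi$; $N,s\Vdash C_G\psi$ iff $N,s\Vdash E_G^n\psi$ for all $n\ge1$; $N,s\Vdash D_G\psi$ iff for all $t$ with $(s,t)\in\bigcap_{a\in G}R(a)$, $N,t\Vdash\psi$. The standard translation of $M=(W,A,E,C,\nu)$ is the relational model $M^\sigma=(W,R,V)$ with $R(a)=\{(s,t)\in W\times W\mid C(a)\subseteq E(s,t)\}$ and $V(p)=\{s\in W\mid p\in\nu(s)\}$. -}

module Defs where

open import Level using (Level)
open import Data.Bool.Base using (true; false)
open import Data.Empty using (⊥-elim-irr)
open import Data.Fin.Base using (Fin; zero; suc)
open import Data.Fin.Subset as Subset using (Subset; Nonempty)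
open import Data.List.Base as List using (List; []; _∷_)
open import Data.List.NonEmpty as List⁺ using (List⁺; _∷_)
open import Data.Nat.Base using (ℕ; zero; suc; _≥_)
open import Data.Nat.GeneralisedArithmetic using (fold)
open import Data.Product.Base using (∃; _×_; _,_; proj₁)
open import Data.Vec.Base using ([]; _∷_; there)
open import Function.Base using (id; _∘_)
open import Function.Bundles using (_↔_; _⇔_; mk⇔; Inverse)
open import Relation.Binary.PropositionalEquality
  using (_≡_; refl; cong; cong₂; trans; sym; subst)
open import Relation.Nullary.Negation.Core using (¬_)
open import Relation.Unary using (Pred; _∈_; _⊆_; ⋃; ⋂)

private
  variable
    ℓ : Level
    n : ℕ

record Signature : Set₁ where
  field
    Prop      : Set
    countable : Prop ↔ ℕ
    Ag        : Set
    size      : ℕ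
    finite    : Ag ↔ Fin size
    someAgent : Ag

elements : Subset n → List (Fin n)
elements []          = []
elements (true  ∷ p) = zero ∷ List.map suc (elements p)
elements (false ∷ p) = List.map suc (elements p)

elements⁺ : (p : Subset n) → .(Nonempty p) → List⁺ (Fin n)
elements⁺ []          ne = ⊥-elim-irr (empty ne)
  where
  empty : ¬ Nonempty []
  empty (() , _)
elements⁺ (true  ∷ p) ne = zero ∷ List.map suc (elements p)
elements⁺ (false ∷ p) ne = List⁺.map suc (elements⁺ p (tail ne))
  where
  tail : Nonempty (false ∷ p) → Nonempty p
  tail (suc x , there x∈p) = x , x∈p

-- Nonemptiness is irrelevant, so that groups with the same members are equal.
record Group (S : Signature) : Set where
  constructor group
  open Signature S
  field
    members   : Subset size
    .nonempty : Nonempty members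

record Model (S : Signature) (ℓ : Level) : Set (Level.suc ℓ) where
  open Signature S
  field
    W         : Set ℓ
    someState : W
    A         : Set ℓ
    E         : W → W → Pred A ℓ
    C         : Ag → Pred A ℓ
    ν         : W → Pred Prop ℓ

record RelationalModel (S : Signature) (ℓ : Level) : Set (Level.suc ℓ) where
  open Signature S
  field
    W         : Set ℓ
    someState : W
    R         : Ag → Pred (W × W) ℓ
    V         : Prop → Pred W ℓ

module ELCD (S : Signature) where

  open Signature S

  _∈ᴳ_ : Ag → Group S → Set
  a ∈ᴳ G = Inverse.to finite a Subset.∈ Group.members G

  agents : Group S → List⁺ Ag
  agents (group p ne) = List⁺.map (Inverse.from finite) (elements⁺ p ne)

  infixr 5 _⇒_
  infixr 6 _∧_
  infix  7 ∼_

  data Formula : Set where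
    var : Prop → Formula
    ∼_  : Formula → Formula
    _⇒_ : Formula → Formula → Formula
    K   : Ag → Formula → Formula
    C   : Group S → Formula → Formula
    D   : Group S → Formula → Formula

  _∧_ : Formula → Formula → Formula
  φ ∧ ψ = ∼ (φ ⇒ ∼ ψ)

  E : Group S → Formula → Formula
  E G φ = List⁺.foldr₁ _∧_ (List⁺.map (λ a → K a φ) (agents G))

  -- Only the exponents n ≥ 1 are used; E^ 1 G φ is E G φ by computation.
  E^ : ℕ → Group S → Formula → Formula
  E^ n G φ = fold φ (E G) n

  -- The clause for C G ψ refers to the formulas E^ n G ψ, which are not
  -- subformulas of C G ψ.  To make satisfaction structurally recursive, the
  -- clause is stated with the operations on truth sets that ∧ and E denote
  -- (given the operation `know a` denoted by K a).  That this is the intended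
  -- clause is proved below, in ⊨-C and ⊩-C.
  module _ {W : Set ℓ} where

    both : Pred W ℓ → Pred W ℓ → Pred W ℓ
    both X Y s = ¬ (X s → ¬ Y s)

    everyone : (Ag → Pred W ℓ → Pred W ℓ) → Group S → Pred W ℓ → Pred W ℓ
    everyone know G X =
      List⁺.foldr₁ both (List⁺.map (λ a → know a X) (agents G))

  module _ (M : Model S ℓ) where

    private module M = Model M

    knowsᴹ : Ag → Pred M.W ℓ → Pred M.W ℓ
    knowsᴹ a X s = ∀ t → M.C a ⊆ M.E s t → X t

  infix 4 _∣_⊨_ _∣_⊩_

  _∣_⊨_ : (M : Model S ℓ) → Model.W M → Formula → Set ℓ
  M ∣ s ⊨ var p   = p ∈ Model.ν M s
  M ∣ s ⊨ ∼ φ     = ¬ (M ∣ s ⊨ φ)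
  M ∣ s ⊨ (φ ⇒ ψ) = M ∣ s ⊨ φ → M ∣ s ⊨ ψ
  M ∣ s ⊨ K a ψ   = knowsᴹ M a (λ t → M ∣ t ⊨ ψ) s
  M ∣ s ⊨ C G ψ   =
    ∀ n → n ≥ 1 → fold (λ t → M ∣ t ⊨ ψ) (everyone (knowsᴹ M) G) n s
  M ∣ s ⊨ D G ψ   =
    ∀ t → ⋃ (∃ (_∈ᴳ G)) (Model.C M ∘ proj₁) ⊆ Model.E M s t → M ∣ t ⊨ ψ

  module _ (N : RelationalModel S ℓ) where

    private module N = RelationalModel N

    knowsᴺ : Ag → Pred N.W ℓ → Pred N.W ℓ
    knowsᴺ a X s = ∀ t → (s , t) ∈ N.R a → X t

  _∣_⊩_ : (N : RelationalModel S ℓ) → RelationalModel.W N → Formula → Set ℓ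
  N ∣ s ⊩ var p   = s ∈ RelationalModel.V N p
  N ∣ s ⊩ ∼ φ     = ¬ (N ∣ s ⊩ φ)
  N ∣ s ⊩ (φ ⇒ ψ) = N ∣ s ⊩ φ → N ∣ s ⊩ ψ
  N ∣ s ⊩ K a ψ   = knowsᴺ N a (λ t → N ∣ t ⊩ ψ) s
  N ∣ s ⊩ C G ψ   =
    ∀ n → n ≥ 1 → fold (λ t → N ∣ t ⊩ ψ) (everyone (knowsᴺ N) G) n s
  N ∣ s ⊩ D G ψ   =
    ∀ t → (s , t) ∈ ⋂ (∃ (_∈ᴳ G)) (RelationalModel.R N ∘ proj₁) → N ∣ t ⊩ ψ

  module _ {W : Set ℓ} (know : Ag → Pred W ℓ → Pred W ℓ)
           (⟦_⟧ : Formula → Pred W ℓ)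
           (⟦∧⟧ : ∀ φ ψ → ⟦ φ ∧ ψ ⟧ ≡ both ⟦ φ ⟧ ⟦ ψ ⟧)
           (⟦K⟧ : ∀ a φ → ⟦ K a φ ⟧ ≡ know a ⟦ φ ⟧) where

    private
      ⟦⋀⟧ : ∀ φ a (as : List Ag) →
            ⟦ List⁺.foldr₁ _∧_ (List⁺.map (λ a → K a φ) (a ∷ as)) ⟧ ≡
            List⁺.foldr₁ both (List⁺.map (λ a → know a ⟦ φ ⟧) (a ∷ as))
      ⟦⋀⟧ φ a []       = ⟦K⟧ a φ
      ⟦⋀⟧ φ a (b ∷ bs) =
        trans (⟦∧⟧ (K a φ) _) (cong₂ both (⟦K⟧ a φ) (⟦⋀⟧ φ b bs))

    ⟦E^⟧ : ∀ n G φ → ⟦ E^ n G φ ⟧ ≡ fold ⟦ φ ⟧ (everyone know G) n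
    ⟦E^⟧ zero    G φ = refl
    ⟦E^⟧ (suc n) G φ = trans
      (⟦⋀⟧ (E^ n G φ) (List⁺.head (agents G)) (List⁺.tail (agents G)))
      (cong (everyone know G) (⟦E^⟧ n G φ))

  ⊨-C : ∀ (M : Model S ℓ) s G ψ →
        M ∣ s ⊨ C G ψ ⇔ (∀ n → n ≥ 1 → M ∣ s ⊨ E^ n G ψ)
  ⊨-C M s G ψ = mk⇔
    (λ h n n≥1 → subst (λ X → X s) (sym (eq n)) (h n n≥1))
    (λ h n n≥1 → subst (λ X → X s) (eq n) (h n n≥1))
    where
    eq : ∀ n → (λ t → M ∣ t ⊨ E^ n G ψ) ≡
               fold (λ t → M ∣ t ⊨ ψ) (everyone (knowsᴹ M) G) n
    eq n = ⟦E^⟧ (knowsᴹ M) (λ φ t → M ∣ t ⊨ φ)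
                (λ _ _ → refl) (λ _ _ → refl) n G ψ

  ⊩-C : ∀ (N : RelationalModel S ℓ) s G ψ →
        N ∣ s ⊩ C G ψ ⇔ (∀ n → n ≥ 1 → N ∣ s ⊩ E^ n G ψ)
  ⊩-C N s G ψ = mk⇔
    (λ h n n≥1 → subst (λ X → X s) (sym (eq n)) (h n n≥1))
    (λ h n n≥1 → subst (λ X → X s) (eq n) (h n n≥1))
    where
    eq : ∀ n → (λ t → N ∣ t ⊩ E^ n G ψ) ≡
               fold (λ t → N ∣ t ⊩ ψ) (everyone (knowsᴺ N) G) n
    eq n = ⟦E^⟧ (knowsᴺ N) (λ φ t → N ∣ t ⊩ φ)
                (λ _ _ → refl) (λ _ _ → refl) n G ψ

  infix 8 _^σ

  _^σ : Model S ℓ → RelationalModel S ℓ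
  M ^σ = record
    { W         = M.W
    ; someState = M.someState
    ; R         = λ a (s , t) → M.C a ⊆ M.E s t
    ; V         = λ p s → p ∈ M.ν s
    }
    where module M = Model M

{-# OPTIONS --safe #-}
-- M and M ^σ interpret every K a by the same operation on truth sets, and the
-- pair (s , t) lies in all R(a), a ∈ G, exactly when E(s,t) contains the union
-- of the C(a).  Hence the induction on φ is immediate except at C G ψ, where it
-- suffices that "everyone in G knows" is monotone, and so are its iterates.

module Submission where

open import Defs
open import Data.List.Base using (List; []; _∷_)
open import Data.List.NonEmpty as List⁺ using (_∷_)
open import Data.Nat.Base using (zero; suc)
open import Data.Nat.GeneralisedArithmetic using (fold)
open import Data.Product.Base using (_,_)
open import Function.Bundles using (_⇔_; mk⇔; Equivalence)
open import Function.Related.TypeIsomorphisms using (→-cong-⇔; ¬-cong-⇔)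
open import Function.Construct.Identity using (⇔-id)
open import Level using (Level)
open import Relation.Unary using (Pred; _⊆_)

open Equivalence using (to; from)

Monotone : ∀ {w ℓ} {W : Set w} → (Pred W ℓ → Pred W ℓ) → Set _
Monotone F = ∀ {X Y} → X ⊆ Y → F X ⊆ F Y

fold-mono : ∀ {w ℓ} {W : Set w} {F : Pred W ℓ → Pred W ℓ} → Monotone F →
            ∀ n → Monotone (λ X → fold X F n)
fold-mono F-mono zero    X⊆Y = X⊆Y
fold-mono F-mono (suc n) X⊆Y = F-mono (fold-mono F-mono n X⊆Y)

module _ (S : Signature) where

  open Signature S
  open ELCD S

  private
    variable
      ℓ : Level

  -- Each argument of `both` occurs positively, to the left of exactly two arrows once the negations
  -- are unfolded.
  both-mono : {W : Set ℓ} {X X′ Y Y′ : Pred W ℓ} →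
              X ⊆ X′ → Y ⊆ Y′ → both X Y ⊆ both X′ Y′
  both-mono X⊆X′ Y⊆Y′ ¬[X→¬Y] X′→¬Y′ =
    ¬[X→¬Y] (λ x y → X′→¬Y′ (X⊆X′ x) (Y⊆Y′ y))

  -- The operation combines the sets `know a X` by `both` alone, so monotonicity passes from agents
  -- to the group by induction on the list of agents; the base case is a single agent.
  everyone-mono : {W : Set ℓ} {know : Ag → Pred W ℓ → Pred W ℓ} →
                  (∀ a → Monotone (know a)) → ∀ G → Monotone (everyone know G)
  everyone-mono {W = W} {know} know-mono G {X} {Y} X⊆Y =
    go (List⁺.head (agents G)) (List⁺.tail (agents G))
    where
    conj : Pred W _ → Ag → List Ag → Pred W _
    conj Z a as = List⁺.foldr₁ both (List⁺.map (λ b → know b Z) (a ∷ as))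

    go : ∀ a as → conj X a as ⊆ conj Y a as
    go a []       = know-mono a X⊆Y
    go a (b ∷ bs) = both-mono {X = know a X} {know a Y} {conj X b bs} {conj Y b bs}
                              (know-mono a X⊆Y) (go b bs)

  knowsᴹ-mono : (M : Model S ℓ) → ∀ a → Monotone (knowsᴹ M a)
  knowsᴹ-mono M a X⊆Y h t r = X⊆Y (h t r)

  ⊨⇔⊩ : (φ : Formula) (M : Model S ℓ) (s : Model.W M) →
        M ∣ s ⊨ φ ⇔ M ^σ ∣ s ⊩ φ
  ⊨⇔⊩ (var p) M s = ⇔-id _
  ⊨⇔⊩ (∼ φ)   M s = ¬-cong-⇔ (⊨⇔⊩ φ M s)
  ⊨⇔⊩ (φ ⇒ ψ) M s = →-cong-⇔ (⊨⇔⊩ φ M s) (⊨⇔⊩ ψ M s)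
  ⊨⇔⊩ (K a ψ) M s = mk⇔
    (λ h t r → to   (⊨⇔⊩ ψ M t) (h t r))
    (λ h t r → from (⊨⇔⊩ ψ M t) (h t r))
  ⊨⇔⊩ (C G ψ) M s = mk⇔
    -- By unfolding `M ^σ`, both sides iterate the same operation, so only the initial truth sets
    -- differ. The induction hypothesis, taken at every `t`, gives their inclusion in each
    -- direction.
    (λ h n n≥1 → iterate-mono n (λ {t} → to   (⊨⇔⊩ ψ M t)) (h n n≥1))
    (λ h n n≥1 → iterate-mono n (λ {t} → from (⊨⇔⊩ ψ M t)) (h n n≥1))
    where
    iterate-mono : ∀ n → Monotone (λ X → fold X (everyone (knowsᴹ M) G) n)
    iterate-mono = fold-mono (everyone-mono {know = knowsᴹ M} (knowsᴹ-mono M) G)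
  ⊨⇔⊩ (D G ψ) M s = mk⇔
    -- The two conditions on `t` differ by currying: an element of the union comes with an agent of
    -- `G`.
    (λ h t r → to   (⊨⇔⊩ ψ M t) (h t (λ { (i , c) → r i c })))
    (λ h t r → from (⊨⇔⊩ ψ M t) (h t (λ i {_} c → r (i , c))))

lemma15 : (S : Signature) → let open ELCD S in
    ∀ {ℓ} (φ : Formula) (M : Model S ℓ) (s : Model.W M) →
    M ∣ s ⊨ φ ⇔ M ^σ ∣ s ⊩ φ
lemma15 S = ⊨⇔⊩ S
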